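{- For every integer $m\ge 3$, the halved cube $\Delta_{m+3}$ is a deletion host for $J_m=K_2\vee(K_m\sqcup K_2)$; that is, $E(\Delta_{m+3})\neq\varnothing$, $\Delta_{m+3}$ contains no induced subgraph isomorphic to $J_m$, and for every edge $e$ of $\Delta_{m+3}$ the graph $\Delta_{m+3}-e$ contains an induced subgraph isomorphic to $J_m$.
   Context: The halved cube $\Delta_n$ is the graph whose vertices are the even-cardinality subsets of $[n]=\{1,\dots,n\}$, with $X,Y$ adjacent if and only if $|X\mathbin{\triangle}Y|=2$ (symmetric difference). $\sqcup$ denotes disjoint union of graphs and $\vee$ denotes the join (disjoint union together with all edges between the two graphs). $\Delta_{m+3}-e$ denotes deletion of the edge $e$, keeping all vertices. -}

module Defs where

open import Data.Bool.Base using (_xor_)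
open import Data.Bool.Properties using (xor-comm; xor-same)
open import Data.Fin.Base using (Fin)
open import Data.Fin.Subset using (Subset; ∣_∣)
open import Data.Nat.Base using (ℕ)
open import Data.Nat.Divisibility using (_∣_)
open import Data.Product.Base using (∃; ∃₂; _×_; _,_)
open import Data.Refinement.Base using (Refinement; value)
open import Data.Sum.Base using (_⊎_; inj₁; inj₂)
open import Data.Sum.Relation.Binary.Pointwise using (Pointwise; inj₁; inj₂; ⊎-symmetric)
open import Data.Unit.Base using (⊤; tt)
open import Data.Vec.Base using ([]; _∷_; zipWith)
open import Data.Vec.Properties using (zipWith-comm)
open import Function.Base using (_∘_)
open import Function.Bundles using (_↔_; _⇔_; Inverse)
open import Level using (0ℓ)
open import Relation.Binary.Core using (Rel)
open import Relation.Binary.Definitions using (Symmetric; Irreflexive)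
open import Relation.Binary.PropositionalEquality
  using (_≡_; _≢_; refl; sym; trans; cong; ≢-sym)
open import Relation.Nullary.Negation using (¬_)
open import Relation.Unary using (Pred)

record Graph : Set₁ where
  field
    Vertex  : Set
    Adj     : Rel Vertex 0ℓ
    symm    : Symmetric Adj
    irrefl  : Irreflexive _≡_ Adj

open Graph public

record _≅_ (G H : Graph) : Set where
  field
    vertices : Vertex G ↔ Vertex H
    adjacent : ∀ x y →
      Adj G x y ⇔ Adj H (Inverse.to vertices x) (Inverse.to vertices y)

infix 4 _≅_

-- The membership proof in a Refinement is irrelevant, so each element of S
-- is a vertex exactly once, whatever the number of proofs of S x.
induced : (G : Graph) → Pred (Vertex G) 0ℓ → Graph
induced G S = record
  { Vertex = Refinement (Vertex G) S
  ; Adj    = λ x y → Adj G (value x) (value y)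
  ; symm   = symm G
  ; irrefl = irrefl G ∘ cong value
  }

ContainsInduced : Graph → Graph → Set₁
ContainsInduced G H = ∃ λ (S : Pred (Vertex G) 0ℓ) → induced G S ≅ H

-- Edges are unordered, so both orientations of uv are removed.
deleteEdge : (G : Graph) (u v : Vertex G) → Graph
deleteEdge G u v = record
  { Vertex = Vertex G
  ; Adj    = λ x y → Adj G x y × ¬ ((x ≡ u × y ≡ v) ⊎ (x ≡ v × y ≡ u))
  ; symm   = λ (xy , kept) → symm G xy , λ
      { (inj₁ (y≡u , x≡v)) → kept (inj₂ (x≡v , y≡u))
      ; (inj₂ (y≡v , x≡u)) → kept (inj₁ (x≡u , y≡v))
      }
  ; irrefl = λ x≡y (xy , _) → irrefl G x≡y xy
  }

record DeletionHost (G H : Graph) : Set₁ where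
  field
    hasEdge       : ∃₂ λ u v → Adj G u v
    inducedFree   : ¬ ContainsInduced G H
    deletionHasIt : ∀ u v → Adj G u v → ContainsInduced (deleteEdge G u v) H

K : ℕ → Graph
K n = record
  { Vertex = Fin n
  ; Adj    = _≢_
  ; symm   = ≢-sym
  ; irrefl = λ x≡y x≢y → x≢y x≡y
  }

infixr 6 _⊔_
infixr 5 _∨_

_⊔_ : Graph → Graph → Graph
G ⊔ H = record
  { Vertex = Vertex G ⊎ Vertex H
  ; Adj    = Pointwise (Adj G) (Adj H)
  ; symm   = ⊎-symmetric (symm G) (symm H)
  ; irrefl = λ { refl (inj₁ a) → irrefl G refl a ; refl (inj₂ b) → irrefl H refl b }
  }

_∨_ : Graph → Graph → Graph
G ∨ H = record
  { Vertex = Vertex G ⊎ Vertex H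
  ; Adj    = adj
  ; symm   = λ {x} {y} → adj-sym x y
  ; irrefl = λ { {x} refl → adj-irrefl x }
  }
  where
  adj : Rel (Vertex G ⊎ Vertex H) 0ℓ
  adj (inj₁ a) (inj₁ b) = Adj G a b
  adj (inj₁ _) (inj₂ _) = ⊤
  adj (inj₂ _) (inj₁ _) = ⊤
  adj (inj₂ a) (inj₂ b) = Adj H a b

  adj-sym : ∀ x y → adj x y → adj y x
  adj-sym (inj₁ _) (inj₁ _) = symm G
  adj-sym (inj₁ _) (inj₂ _) = λ _ → tt
  adj-sym (inj₂ _) (inj₁ _) = λ _ → tt
  adj-sym (inj₂ _) (inj₂ _) = symm H

  adj-irrefl : ∀ x → ¬ adj x x
  adj-irrefl (inj₁ _) = irrefl G refl
  adj-irrefl (inj₂ _) = irrefl H refl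

infixr 6 _△_

_△_ : ∀ {n} → Subset n → Subset n → Subset n
X △ Y = zipWith _xor_ X Y

△-comm : ∀ {n} (X Y : Subset n) → X △ Y ≡ Y △ X
△-comm = zipWith-comm xor-comm

∣X△X∣≡0 : ∀ {n} (X : Subset n) → ∣ X △ X ∣ ≡ 0
∣X△X∣≡0 []      = refl
∣X△X∣≡0 (x ∷ X) rewrite xor-same x = ∣X△X∣≡0 X

-- Subsets of [n] are represented as subsets of Fin n; evenness is irrelevant,
-- so vertices are equal exactly when their underlying subsets are.
Δ : ℕ → Graph
Δ n = record
  { Vertex = Refinement (Subset n) λ X → 2 ∣ ∣ X ∣
  ; Adj    = λ X Y → ∣ value X △ value Y ∣ ≡ 2
  ; symm   = λ {X} {Y} → trans (cong ∣_∣ (△-comm (value Y) (value X)))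
  ; irrefl = λ { {X} refl 0≡2 → 0≢2 (trans (sym (∣X△X∣≡0 (value X))) 0≡2) }
  }
  where
  0≢2 : 0 ≢ 2
  0≢2 ()

J : ℕ → Graph
J m = K 2 ∨ (K m ⊔ K 2)

{-# OPTIONS --safe #-}

-- The common neighbours of an edge {a , a △ {p , q}} of Δ (m + 3) are the sets
-- a △ {t , k} with t ∈ {p , q} and k ∉ {p , q}. They form a 2 × (m + 1) rook graph:
-- two of them are adjacent iff they agree in exactly one of t and k. In it, K m with
-- m ≥ 3 lies in one row, so a K 2 without edges to K m lies in the other row and
-- avoids the columns of K m; since only one further column exists, J m is not induced.
-- If the edge between the two vertices of one column is deleted, K 2 may use that
-- column as well, and every edge of Δ (m + 3) arises as such a column edge.

module Submission where

open import Defs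
open import Data.Nat.Base using (ℕ; _≤_; _+_)

open import Data.Bool.Base using (true; false; not; _xor_)
open import Data.Bool.Properties as Bool using (not-involutive)
open import Data.Empty using (⊥)
open import Data.Fin.Base using (Fin; zero; suc; punchIn; punchOut; splitAt; join; _↑ˡ_)
open import Data.Fin.Properties
  using (_≟_; any?; suc-injective; punchIn-injective; punchInᵢ≢i; punchIn-punchOut;
         join-splitAt; injective⇒≤; ↑ˡ-injective)
open import Data.Fin.Subset using (Subset; ∣_∣) renaming (⊥ to ∅)
open import Data.Fin.Subset.Properties using (∣⊥∣≡0)
open import Data.Irrelevant using ([_])
open import Data.Nat.Base using (zero; suc; z≤n; s≤s)
open import Data.Nat.Divisibility using (_∣_; _∣0; ∣m+n∣m⇒∣n; ∣m∣n⇒∣m+n; ∣-refl)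
open import Data.Nat.Properties using (+-comm; 1+n≰n; ≤-trans; ≤-reflexive)
open import Data.Product.Base using (∃; _×_; _,_; proj₁; proj₂)
import Data.Refinement.Base as Refinement
open Refinement using (Refinement; value)
import Data.Refinement.Properties as Refinement
open import Data.Sum.Base using (_⊎_; inj₁; inj₂)
open import Data.Sum.Properties using (inj₂-injective; ≡-dec)
open import Data.Sum.Relation.Binary.Pointwise using (inj₁; inj₂)
open import Data.Unit.Base using (tt)
open import Data.Vec.Base using ([]; _∷_; lookup; updateAt)
open import Data.Vec.Properties as Vec
  using (lookup∘updateAt′; updateAt-commutes; updateAt-id; updateAt-updateAt-local)
open import Function.Base using (_∘_; id; case_of_)
open import Function.Bundles using (mk⇔; mk↔ₛ′; Inverse; Equivalence)
open import Function.Definitions using (Injective)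
open import Relation.Binary.Definitions using (DecidableEquality)
open import Relation.Binary.PropositionalEquality
  using (_≡_; _≢_; refl; sym; trans; cong; subst; subst₂; ≢-sym)
open import Relation.Nullary.Decidable
  using (Dec; _⊎-dec_; yes; no; map′; recompute; decidable-stable)
open import Relation.Nullary.Negation using (¬_; contradiction)

-- Induced subgraphs as embeddings.

record InducedEmbedding (H G : Graph) : Set where
  field
    image     : Vertex H → Vertex G
    injective : ∀ {x y} → image x ≡ image y → x ≡ y
    preserves : ∀ {x y} → Adj H x y → Adj G (image x) (image y)
    reflects  : ∀ {x y} → Adj G (image x) (image y) → Adj H x y

open InducedEmbedding

containsInduced⇒embedding : ∀ {G H} → ContainsInduced G H → InducedEmbedding H G
containsInduced⇒embedding {G} {H} (S , iso) = record
  { image     = value ∘ from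
  ; injective = λ {x} {y} eq → trans (sym (to∘from x))
      (trans (cong to (Refinement.value-injective eq)) (to∘from y))
  ; preserves = λ {x} {y} xy → Equivalence.from (adjacent (from x) (from y))
      (subst₂ (Adj H) (sym (to∘from x)) (sym (to∘from y)) xy)
  ; reflects  = λ {x} {y} xy → subst₂ (Adj H) (to∘from x) (to∘from y)
      (Equivalence.to (adjacent (from x) (from y)) xy)
  }
  where
  open _≅_ iso
  open Inverse vertices using (to; from)
  to∘from : ∀ x → to (from x) ≡ x
  to∘from x = Inverse.strictlyInverseˡ vertices x

-- Membership in an induced subgraph is irrelevant, so the preimage of a vertex
-- has to be found again by search.
embedding⇒containsInduced : ∀ {G H} (f : InducedEmbedding H G) →
  (∀ v → Dec (∃ λ x → image f x ≡ v)) → ContainsInduced G H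
embedding⇒containsInduced {G} {H} f image? = S , record
  { vertices = mk↔ₛ′ to from to∘from from∘to
  ; adjacent = λ v w → mk⇔
      (λ vw → reflects f (subst₂ (Adj G) (sym (image-to v)) (sym (image-to w)) vw))
      (λ vw → subst₂ (Adj G) (image-to v) (image-to w) (preserves f vw))
  }
  where
  S : Vertex G → Set
  S v = ∃ λ x → image f x ≡ v
  preimage : (v : Refinement (Vertex G) S) → S (value v)
  preimage (v Refinement., [ v∈S ]) = recompute (image? v) v∈S
  to : Refinement (Vertex G) S → Vertex H
  to v = proj₁ (preimage v)
  image-to : ∀ v → image f (to v) ≡ value v
  image-to v = proj₂ (preimage v)
  from : Vertex H → Refinement (Vertex G) S
  from x = image f x Refinement., [ x , refl ]
  to∘from : ∀ x → to (from x) ≡ x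
  to∘from x = injective f (image-to (from x))
  from∘to : ∀ v → from (to v) ≡ v
  from∘to v = Refinement.value-injective (image-to v)

-- Toggling elements and the size of symmetric differences.

toggle : ∀ {n} → Fin n → Subset n → Subset n
toggle i X = updateAt X i not

dist : ∀ {n} → Subset n → Subset n → ℕ
dist X Y = ∣ X △ Y ∣

toggle-involutive : ∀ {n} (i : Fin n) X → toggle i (toggle i X) ≡ X
toggle-involutive i X = trans
  (updateAt-updateAt-local i {h = id} X (not-involutive (lookup X i))) (updateAt-id i X)

toggle-comm : ∀ {n} (i j : Fin n) X → toggle i (toggle j X) ≡ toggle j (toggle i X)
toggle-comm i j X with i ≟ j
... | yes refl = refl
... | no i≢j   = updateAt-commutes i j i≢j X

lookup-toggle : ∀ {n} {i j : Fin n} X → i ≢ j → lookup (toggle j X) i ≡ lookup X i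
lookup-toggle {i = i} {j} X i≢j = lookup∘updateAt′ i j i≢j X

dist-refl : ∀ {n} (X : Subset n) → dist X X ≡ 0
dist-refl = ∣X△X∣≡0

dist-sym : ∀ {n} (X Y : Subset n) → dist X Y ≡ dist Y X
dist-sym X Y = cong ∣_∣ (△-comm X Y)

dist≡suc⇒≢ : ∀ {n k} {X Y : Subset n} → dist X Y ≡ suc k → X ≢ Y
dist≡suc⇒≢ {X = X} eq refl with () ← trans (sym eq) (dist-refl X)

dist≡0⇒≡ : ∀ {n} (X Y : Subset n) → dist X Y ≡ 0 → X ≡ Y
dist≡0⇒≡ []          []          _  = refl
dist≡0⇒≡ (false ∷ X) (false ∷ Y) eq = cong (false ∷_) (dist≡0⇒≡ X Y eq)
dist≡0⇒≡ (true ∷ X)  (true ∷ Y)  eq = cong (true ∷_) (dist≡0⇒≡ X Y eq)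

-- A positive distance leaves some position where `X` and `Y` differ; toggling the first such
-- position repairs exactly that difference.
dist-suc⇒toggle : ∀ {n k} (X Y : Subset n) → dist X Y ≡ suc k →
  ∃ λ i → dist (toggle i X) Y ≡ k
dist-suc⇒toggle []          []          ()
dist-suc⇒toggle (false ∷ X) (false ∷ Y) eq with i , eq′ ← dist-suc⇒toggle X Y eq = suc i , eq′
dist-suc⇒toggle (true ∷ X)  (true ∷ Y)  eq with i , eq′ ← dist-suc⇒toggle X Y eq = suc i , eq′
dist-suc⇒toggle (false ∷ X) (true ∷ Y)  refl = zero , refl
dist-suc⇒toggle (true ∷ X)  (false ∷ Y) refl = zero , refl

dist-toggle : ∀ {n} (i : Fin n) X Y → lookup X i ≡ lookup Y i →
  dist (toggle i X) Y ≡ suc (dist X Y)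
dist-toggle zero    (false ∷ X) (false ∷ Y) _  = refl
dist-toggle zero    (true ∷ X)  (true ∷ Y)  _  = refl
dist-toggle (suc i) (x ∷ X)     (y ∷ Y)     eq with x xor y
... | false = dist-toggle i X Y eq
... | true  = cong suc (dist-toggle i X Y eq)

not-xor-not : ∀ x y → not x xor not y ≡ x xor y
not-xor-not false y = not-involutive y
not-xor-not true  y = refl

-- Toggling the same element in both sets leaves their symmetric difference unchanged. Shared
-- toggles can therefore be cancelled or inserted freely when a distance is computed.
dist-toggle-both : ∀ {n} (i : Fin n) X Y → dist (toggle i X) (toggle i Y) ≡ dist X Y
dist-toggle-both zero    (x ∷ X) (y ∷ Y) rewrite not-xor-not x y = refl
dist-toggle-both (suc i) (x ∷ X) (y ∷ Y) with x xor y
... | false = dist-toggle-both i X Y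
... | true  = cong suc (dist-toggle-both i X Y)

dist-one-one : ∀ {n} {i j : Fin n} X → i ≢ j → dist (toggle i X) (toggle j X) ≡ 2
dist-one-one {i = i} {j} X i≢j = trans
  (dist-toggle i X (toggle j X) (sym (lookup-toggle X i≢j)))
  (cong suc (trans (dist-sym X (toggle j X))
    (trans (dist-toggle j X X refl) (cong suc (dist-refl X)))))

dist-two-two-shared : ∀ {n} (i {j k} : Fin n) X → j ≢ k →
  dist (toggle i (toggle j X)) (toggle i (toggle k X)) ≡ 2
dist-two-two-shared i {j} {k} X j≢k =
  trans (dist-toggle-both i (toggle j X) (toggle k X)) (dist-one-one X j≢k)

dist-two-zero : ∀ {n} {i j : Fin n} X → i ≢ j → dist X (toggle i (toggle j X)) ≡ 2
dist-two-zero {i = i} {j} X i≢j = trans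
  (sym (dist-toggle-both i X (toggle i (toggle j X))))
  (trans (cong (dist (toggle i X)) (toggle-involutive i (toggle j X))) (dist-one-one X i≢j))

-- Before `i` and `j` are toggled, `X` and `Y` agree at both, so each toggle adds one to the
-- distance 2 between `X` and `Y`.
dist-two-two : ∀ {n} {i j k l : Fin n} X → i ≢ j → i ≢ k → i ≢ l → j ≢ k → j ≢ l → k ≢ l →
  dist (toggle i (toggle j X)) (toggle k (toggle l X)) ≡ 4
dist-two-two {i = i} {j} {k} {l} X i≢j i≢k i≢l j≢k j≢l k≢l = trans
  (dist-toggle i (toggle j X) Y (trans (lookup-toggle X i≢j) (sym (lookup-Y i≢k i≢l))))
  (cong suc (trans (dist-toggle j X Y (sym (lookup-Y j≢k j≢l)))
    (cong suc (dist-two-zero X k≢l))))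
  where
  Y = toggle k (toggle l X)
  lookup-Y : ∀ {h} → h ≢ k → h ≢ l → lookup Y h ≡ lookup X h
  lookup-Y h≢k h≢l = trans (lookup-toggle (toggle l X) h≢k) (lookup-toggle X h≢l)

-- Two successive repairs turn `X` into `Y`. Repairing the same position twice would restore `X`,
-- which is not at distance 2 from itself, so the positions differ.
dist≡2⇒toggles : ∀ {n} (X Y : Subset n) → dist X Y ≡ 2 →
  ∃ λ i → ∃ λ j → i ≢ j × Y ≡ toggle i (toggle j X)
dist≡2⇒toggles X Y eq with j , eq₁ ← dist-suc⇒toggle X Y eq
  with i , eq₀ ← dist-suc⇒toggle (toggle j X) Y eq₁ = i , j , i≢j , Y≡
  where
  Y≡ : Y ≡ toggle i (toggle j X)
  Y≡ = sym (dist≡0⇒≡ (toggle i (toggle j X)) Y eq₀)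
  i≢j : i ≢ j
  i≢j refl = dist≡suc⇒≢ eq (sym (trans Y≡ (toggle-involutive i X)))

even-toggle-toggle : ∀ {n} (i j : Fin n) X → 2 ∣ ∣ X ∣ → 2 ∣ ∣ toggle i (toggle j X) ∣
even-toggle-toggle i j X 2∣X = odd⇒even i (toggle j X) (even⇒odd j X 2∣X)
  where
  step : ∀ {n} (i : Fin n) X → ∣ toggle i X ∣ ≡ suc ∣ X ∣ ⊎ ∣ X ∣ ≡ suc ∣ toggle i X ∣
  step zero    (false ∷ X) = inj₁ refl
  step zero    (true ∷ X)  = inj₂ refl
  step (suc i) (false ∷ X) = step i X
  step (suc i) (true ∷ X) with step i X
  ... | inj₁ eq = inj₁ (cong suc eq)
  ... | inj₂ eq = inj₂ (cong suc eq)
  -- Oddness of a cardinality is expressed as evenness of its successor.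
  even⇒odd : ∀ {n} (i : Fin n) X → 2 ∣ ∣ X ∣ → 2 ∣ suc (∣ toggle i X ∣)
  even⇒odd i X 2∣X with step i X
  ... | inj₁ eq rewrite eq = ∣m∣n⇒∣m+n ∣-refl 2∣X
  ... | inj₂ eq = subst (2 ∣_) eq 2∣X
  odd⇒even : ∀ {n} (i : Fin n) X → 2 ∣ suc (∣ X ∣) → 2 ∣ ∣ toggle i X ∣
  odd⇒even i X 2∣1+X with step i X
  ... | inj₁ eq = subst (2 ∣_) (sym eq) 2∣1+X
  ... | inj₂ eq rewrite eq = ∣m+n∣m⇒∣n 2∣1+X ∣-refl

toggle² : ∀ {n} → Fin n → Fin n → Vertex (Δ n) → Vertex (Δ n)
toggle² i j = Refinement.map (toggle i ∘ toggle j) (λ {X} → even-toggle-toggle i j X)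

-- The common neighbours of an edge as a grid with two rows.

-- Two distinct elements p, q are given as p and q = punchIn p q′.
ends : ∀ {m} → Fin (3 + m) → Fin (2 + m) → Fin 2 → Fin (3 + m)
ends p q′ zero       = p
ends p q′ (suc zero) = punchIn p q′

others : ∀ {m} → Fin (3 + m) → Fin (2 + m) → Fin (suc m) → Fin (3 + m)
others p q′ k = punchIn p (punchIn q′ k)

others-injective : ∀ {m} p q′ {k l : Fin (suc m)} → others p q′ k ≡ others p q′ l → k ≡ l
others-injective p q′ {k} {l} =
  punchIn-injective q′ k l ∘ punchIn-injective p (punchIn q′ k) (punchIn q′ l)

ends≢others : ∀ {m} p q′ t (k : Fin (suc m)) → ends p q′ t ≢ others p q′ k
ends≢others p q′ zero       k = ≢-sym (punchInᵢ≢i p (punchIn q′ k))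
ends≢others p q′ (suc zero) k = ≢-sym (punchInᵢ≢i q′ k ∘ punchIn-injective p _ _)

ends-distinct : ∀ {m} (p : Fin (3 + m)) q′ {t t′} → t ≢ t′ → ends p q′ t ≢ ends p q′ t′
ends-distinct p q′ {zero}     {zero}     t≢t′ = contradiction refl t≢t′
ends-distinct p q′ {zero}     {suc zero} _    = ≢-sym (punchInᵢ≢i p q′)
ends-distinct p q′ {suc zero} {zero}     _    = punchInᵢ≢i p q′
ends-distinct p q′ {suc zero} {suc zero} t≢t′ = contradiction refl t≢t′

end-or-other : ∀ {m} (p : Fin (3 + m)) q′ i →
  (∃ λ t → i ≡ ends p q′ t) ⊎ (∃ λ k → i ≡ others p q′ k)
end-or-other p q′ i with p ≟ i
... | yes refl = inj₁ (zero , refl)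
... | no p≢i with q′ ≟ punchOut p≢i
...   | yes refl = inj₁ (suc zero , sym (punchIn-punchOut p≢i))
...   | no q′≢i  = inj₂ (punchOut q′≢i ,
  sym (trans (cong (punchIn p) (punchIn-punchOut q′≢i)) (punchIn-punchOut p≢i)))

opposite : ∀ {m} → Fin (3 + m) → Fin (2 + m) → Subset (3 + m) → Subset (3 + m)
opposite p q′ a = toggle p (toggle (punchIn p q′) a)

-- The row records which end of {p , q} is toggled, and the column which element outside {p , q}.
grid : ∀ {m} → Fin (3 + m) → Fin (2 + m) → Subset (3 + m) → Fin 2 → Fin (suc m) →
  Subset (3 + m)
grid p q′ a t k = toggle (ends p q′ t) (toggle (others p q′ k) a)

dist-opposite : ∀ {m} (p : Fin (3 + m)) q′ a → dist a (opposite p q′ a) ≡ 2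
dist-opposite p q′ a = dist-two-zero a (≢-sym (punchInᵢ≢i p q′))

adjacent⇒opposite : ∀ {m} (a b : Subset (3 + m)) → dist a b ≡ 2 →
  ∃ λ p → ∃ λ q′ → b ≡ opposite p q′ a
adjacent⇒opposite a b ab with p , q , p≢q , b≡ ← dist≡2⇒toggles a b ab =
  p , punchOut p≢q ,
  trans b≡ (cong (λ q → toggle p (toggle q a)) (sym (punchIn-punchOut p≢q)))

dist-grid : ∀ {m} (p : Fin (3 + m)) q′ a t k → dist a (grid p q′ a t k) ≡ 2
dist-grid p q′ a t k = dist-two-zero a (ends≢others p q′ t k)

-- Both sets toggle the end of row `t`. After cancelling it, one set toggles the other end and the
-- other set the column element, which is a different element.
dist-opposite-grid : ∀ {m} (p : Fin (3 + m)) q′ a t k →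
  dist (opposite p q′ a) (grid p q′ a t k) ≡ 2
dist-opposite-grid p q′ a zero       k =
  dist-two-two-shared p a (ends≢others p q′ (suc zero) k)
dist-opposite-grid p q′ a (suc zero) k rewrite toggle-comm p (punchIn p q′) a =
  dist-two-two-shared (punchIn p q′) a (ends≢others p q′ zero k)

grid-row : ∀ {m} (p : Fin (3 + m)) q′ a t {k l} → k ≢ l →
  dist (grid p q′ a t k) (grid p q′ a t l) ≡ 2
grid-row p q′ a t k≢l =
  dist-two-two-shared (ends p q′ t) a (k≢l ∘ others-injective p q′)

grid-column : ∀ {m} (p : Fin (3 + m)) q′ a k {t t′} → t ≢ t′ →
  dist (grid p q′ a t k) (grid p q′ a t′ k) ≡ 2
grid-column p q′ a k t≢t′ = dist-one-one (toggle (others p q′ k) a) (ends-distinct p q′ t≢t′)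

grid-diagonal : ∀ {m} (p : Fin (3 + m)) q′ a {t t′ k l} → t ≢ t′ → k ≢ l →
  dist (grid p q′ a t k) (grid p q′ a t′ l) ≡ 4
grid-diagonal p q′ a {t} {t′} {k} {l} t≢t′ k≢l = dist-two-two a
  (ends≢others p q′ t k) (ends-distinct p q′ t≢t′) (ends≢others p q′ t l)
  (≢-sym (ends≢others p q′ t′ k)) (k≢l ∘ others-injective p q′) (ends≢others p q′ t′ l)

-- Being at distance 2 from `a`, `x` arises by toggling two elements `i` and `j`. If both are ends,
-- `x` is the opposite vertex itself; if neither is, `x` is at distance 4 from it. Hence exactly one
-- is an end, which gives the grid coordinates.
common-neighbour⇒grid : ∀ {m} (p : Fin (3 + m)) q′ a x →
  dist a x ≡ 2 → dist (opposite p q′ a) x ≡ 2 → ∃ λ t → ∃ λ k → x ≡ grid p q′ a t k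
common-neighbour⇒grid p q′ a x ax bx with i , j , i≢j , refl ← dist≡2⇒toggles a x ax
  with end-or-other p q′ i | end-or-other p q′ j
... | inj₁ (t , refl) | inj₂ (k , refl) = t , k , refl
... | inj₂ (k , refl) | inj₁ (t , refl) = t , k , toggle-comm _ _ a
... | inj₁ (zero , refl)     | inj₁ (zero , refl)     = contradiction refl i≢j
... | inj₁ (suc zero , refl) | inj₁ (suc zero , refl) = contradiction refl i≢j
... | inj₁ (zero , refl)     | inj₁ (suc zero , refl) =
  contradiction (refl {x = opposite p q′ a}) (dist≡suc⇒≢ bx)
... | inj₁ (suc zero , refl) | inj₁ (zero , refl)     =
  contradiction (toggle-comm p (punchIn p q′) a) (dist≡suc⇒≢ bx)
... | inj₂ (k , refl) | inj₂ (l , refl) = contradiction (trans (sym bx) (dist-two-two a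
  (≢-sym (punchInᵢ≢i p q′)) (ends≢others p q′ zero k) (ends≢others p q′ zero l)
  (ends≢others p q′ (suc zero) k) (ends≢others p q′ (suc zero) l) i≢j)) λ ()

-- The link of the two apex vertices does not fit in the rook graph.

Link : ℕ → Graph
Link m = K m ⊔ K 2

_≟ᴸ_ : ∀ {m} → DecidableEquality (Vertex (Link m))
_≟ᴸ_ = ≡-dec _≟_ _≟_

RookAdj : ∀ {n} (t t′ : Fin 2) (k l : Fin n) → Set
RookAdj t t′ k l = (t ≡ t′ × k ≢ l) ⊎ (t ≢ t′ × k ≡ l)

opposite-end : ∀ {s t u : Fin 2} → s ≢ t → s ≢ u → t ≡ u
opposite-end {zero}     {zero}                s≢t _   = contradiction refl s≢t
opposite-end {zero}     {suc zero} {zero}     _   s≢u = contradiction refl s≢u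
opposite-end {zero}     {suc zero} {suc zero} _   _   = refl
opposite-end {suc zero} {zero}     {zero}     _   _   = refl
opposite-end {suc zero} {zero}     {suc zero} _   s≢u = contradiction refl s≢u
opposite-end {suc zero} {suc zero}            s≢t _   = contradiction refl s≢t

-- The two ends of a column edge have no common neighbour: a column has only two cells, and a cell
-- elsewhere shares a row with just one of the ends. So every edge of a triangle runs along a row.
rook-triangle : ∀ {n} {t u v : Fin 2} {k l h : Fin n} →
  RookAdj t u k l → RookAdj t v k h → RookAdj u v l h → t ≡ u
rook-triangle (inj₁ (t≡u , _)) _ _ = t≡u
rook-triangle (inj₂ (t≢u , k≡l)) (inj₁ (refl , _)) (inj₁ (u≡t , _)) = sym u≡t
rook-triangle (inj₂ (t≢u , refl)) (inj₁ (_ , k≢h)) (inj₂ (_ , k≡h)) = contradiction k≡h k≢h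
rook-triangle (inj₂ (t≢u , refl)) (inj₂ (_ , k≡h)) (inj₁ (_ , k≢h)) = contradiction k≡h k≢h
rook-triangle (inj₂ (t≢u , _)) (inj₂ (t≢v , _)) (inj₂ (u≢v , _)) =
  contradiction (opposite-end t≢u t≢v) u≢v

-- All 5 + m vertices of the link need different columns, but only 4 + m columns are available.
link-not-in-rook : ∀ {m} (t : Vertex (Link (3 + m)) → Fin 2)
  (k : Vertex (Link (3 + m)) → Fin (4 + m)) →
  (∀ {x y} → Adj (Link (3 + m)) x y → RookAdj (t x) (t y) (k x) (k y)) →
  (∀ {x y} → x ≢ y → ¬ Adj (Link (3 + m)) x y → t x ≢ t y × k x ≢ k y) → ⊥
link-not-in-rook {m} t k adj nonadj =
  1+n≰n (≤-trans (≤-reflexive (+-comm 2 (3 + m))) (injective⇒≤ column-injective))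
  where
  -- The clique has at least three vertices, so some vertex avoids both `i` and `j` and completes a
  -- triangle with them. That vertex is obtained by punching in past `j′` and then past `i`.
  clique-row : ∀ {i j} → i ≢ j → t (inj₁ i) ≡ t (inj₁ j)
  clique-row {i} {j} i≢j = rook-triangle
    (adj (inj₁ i≢j)) (adj (inj₁ (≢-sym (punchInᵢ≢i i _)))) (adj (inj₁ j≢third))
    where
    j′ = punchOut i≢j
    j≢third : j ≢ punchIn i (punchIn j′ zero)
    j≢third eq = punchInᵢ≢i j′ zero
      (sym (punchIn-injective i _ _ (trans (punchIn-punchOut i≢j) eq)))

  columns-distinct : ∀ x y → x ≢ y → k x ≢ k y
  columns-distinct (inj₁ i) (inj₂ j) x≢y = proj₂ (nonadj x≢y λ ())
  columns-distinct (inj₂ j) (inj₁ i) x≢y = proj₂ (nonadj x≢y λ ())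
  columns-distinct (inj₁ i) (inj₁ j) x≢y with i≢j ← x≢y ∘ cong inj₁ | adj (inj₁ i≢j)
  ... | inj₁ (_ , k≢)  = k≢
  ... | inj₂ (t≢ , _) = contradiction (clique-row i≢j) t≢
  -- Neither end of `K 2` is adjacent to the clique vertex `inj₁ zero`, so both lie in the row that
  -- avoids it. Sharing a row, they must differ in their columns.
  columns-distinct (inj₂ i) (inj₂ j) x≢y with adj (inj₂ (x≢y ∘ cong inj₂))
  ... | inj₁ (_ , k≢)  = k≢
  ... | inj₂ (t≢ , _) = contradiction (opposite-end (c≢d i) (c≢d j)) t≢
    where
    c≢d : ∀ l → t (inj₁ zero) ≢ t (inj₂ l)
    c≢d l = proj₁ (nonadj (λ ()) λ ())

  column-injective : Injective _≡_ _≡_ (k ∘ splitAt (3 + m))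
  column-injective {i} {j} eq = trans (sym (join-splitAt (3 + m) 2 i)) (trans
    -- `columns-distinct` gives only the contrapositive of injectivity; decidable equality on the
    -- link removes the double negation.
    (cong (join (3 + m) 2) (decidable-stable (x ≟ᴸ y) λ x≢y → columns-distinct x y x≢y eq))
    (join-splitAt (3 + m) 2 j))
    where
    x = splitAt (3 + m) i
    y = splitAt (3 + m) j

-- The halved cube has no induced `J`.

grid-rook : ∀ {m} (p : Fin (3 + m)) q′ a {t t′ k l} →
  dist (grid p q′ a t k) (grid p q′ a t′ l) ≡ 2 → RookAdj t t′ k l
grid-rook p q′ a {t} {t′} {k} {l} eq with t ≟ t′ | k ≟ l
... | yes t≡t′ | no k≢l  = inj₁ (t≡t′ , k≢l)
... | no t≢t′  | yes k≡l = inj₂ (t≢t′ , k≡l)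
... | yes refl | yes refl = contradiction (refl {x = grid p q′ a t k}) (dist≡suc⇒≢ eq)
... | no t≢t′  | no k≢l
  with () ← trans (sym eq) (grid-diagonal p q′ a t≢t′ k≢l)

grid-apart : ∀ {m} (p : Fin (3 + m)) q′ a {t t′ k l} →
  grid p q′ a t k ≢ grid p q′ a t′ l → dist (grid p q′ a t k) (grid p q′ a t′ l) ≢ 2 →
  t ≢ t′ × k ≢ l
grid-apart p q′ a {t} {t′} {k} {l} distinct nonadj with t ≟ t′ | k ≟ l
... | no t≢t′  | no k≢l   = t≢t′ , k≢l
... | yes refl | no k≢l   = contradiction (grid-row p q′ a t k≢l) nonadj
... | no t≢t′  | yes refl = contradiction (grid-column p q′ a k t≢t′) nonadj
... | yes refl | yes refl = contradiction refl distinct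

-- The two apex vertices of an induced copy span an edge, and every link vertex is a common
-- neighbour of its ends. The grid coordinates then place the link inside the rook graph, which is
-- impossible.
Δ-free : ∀ m → ¬ ContainsInduced (Δ (6 + m)) (J (3 + m))
Δ-free m contains = from-edge (adjacent⇒opposite (X (inj₁ zero)) _ (preserves f λ ()))
  where
  f : InducedEmbedding (J (3 + m)) (Δ (6 + m))
  f = containsInduced⇒embedding contains
  X : Vertex (J (3 + m)) → Subset (6 + m)
  X = value ∘ image f
  from-edge : (∃ λ p → ∃ λ q′ → X (inj₁ (suc zero)) ≡ opposite p q′ (X (inj₁ zero))) → ⊥
  from-edge (p , q′ , b≡) = link-not-in-rook row column
    (λ {x} {y} xy → grid-rook p q′ a
      (subst₂ (λ X Y → dist X Y ≡ 2) (X≡ x) (X≡ y) (preserves f xy)))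
    (λ {x} {y} x≢y ¬xy → grid-apart p q′ a
      (λ eq → x≢y (inj₂-injective (injective f
        (Refinement.value-injective (trans (X≡ x) (trans eq (sym (X≡ y))))))))
      (λ eq → ¬xy (reflects f
        (subst₂ (λ X Y → dist X Y ≡ 2) (sym (X≡ x)) (sym (X≡ y)) eq))))
    where
    a = X (inj₁ zero)
    coordinates : ∀ x → ∃ λ t → ∃ λ k → X (inj₂ x) ≡ grid p q′ a t k
    coordinates x = common-neighbour⇒grid p q′ a (X (inj₂ x)) (preserves f tt)
      (subst (λ Y → dist Y (X (inj₂ x)) ≡ 2) b≡ (preserves f tt))
    row : Vertex (Link (3 + m)) → Fin 2
    row x = proj₁ (coordinates x)
    column : Vertex (Link (3 + m)) → Fin (4 + m)
    column x = proj₁ (proj₂ (coordinates x))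
    X≡ : ∀ x → X (inj₂ x) ≡ grid p q′ a (row x) (column x)
    X≡ x = proj₂ (proj₂ (coordinates x))

-- An induced `J` after the deletion of an edge.

-- These are the non-edges of `J m` between distinct vertices, in both orientations; they occur only
-- between the two parts of the link.
data Apart {m} : (x y : Vertex (J m)) → Set where
  clique-edge : ∀ i j → Apart (inj₂ (inj₁ i)) (inj₂ (inj₂ j))
  edge-clique : ∀ i j → Apart (inj₂ (inj₂ j)) (inj₂ (inj₁ i))

equal-adjacent-or-apart : ∀ {m} (x y : Vertex (J m)) → x ≡ y ⊎ Adj (J m) x y ⊎ Apart x y
equal-adjacent-or-apart (inj₁ _) (inj₂ _) = inj₂ (inj₁ tt)
equal-adjacent-or-apart (inj₂ _) (inj₁ _) = inj₂ (inj₁ tt)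
equal-adjacent-or-apart (inj₁ s) (inj₁ t) with s ≟ t
... | yes refl = inj₁ refl
... | no s≢t   = inj₂ (inj₁ s≢t)
equal-adjacent-or-apart (inj₂ (inj₁ i)) (inj₂ (inj₁ j)) with i ≟ j
... | yes refl = inj₁ refl
... | no i≢j   = inj₂ (inj₁ (inj₁ i≢j))
equal-adjacent-or-apart (inj₂ (inj₂ i)) (inj₂ (inj₂ j)) with i ≟ j
... | yes refl = inj₁ refl
... | no i≢j   = inj₂ (inj₁ (inj₂ i≢j))
equal-adjacent-or-apart (inj₂ (inj₁ i)) (inj₂ (inj₂ j)) = inj₂ (inj₂ (clique-edge i j))
equal-adjacent-or-apart (inj₂ (inj₂ j)) (inj₂ (inj₁ i)) = inj₂ (inj₂ (edge-clique i j))

-- The link is placed in the grid with its two cliques in different rows, so that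
-- they overlap in exactly one column; the edge in that column is the one deleted.
place : ∀ {m} → Fin (4 + m) → Fin (3 + m) → Vertex (Δ (4 + m)) → Vertex (J (1 + m)) →
  Vertex (Δ (4 + m))
place p q′ a (inj₁ zero)       = a
place p q′ a (inj₁ (suc zero)) = toggle² p (punchIn p q′) a
place p q′ a (inj₂ (inj₁ i))   = toggle² p (others p q′ (suc i)) a
place {m} p q′ a (inj₂ (inj₂ j)) = toggle² (punchIn p q′) (others p q′ (j ↑ˡ m)) a

-- In `place` the clique fills every column except 0 of the row of `p`, and `K 2` fills columns 0
-- and 1 of the other row. These are the two vertices in the shared column 1.
c₀ d₁ : ∀ {m} → Vertex (J (1 + m))
c₀ = inj₂ (inj₁ zero)
d₁ = inj₂ (inj₂ (suc zero))

place-apex-link : ∀ {m} p q′ (a : Vertex (Δ (4 + m))) t x →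
  dist (value (place p q′ a (inj₁ t))) (value (place p q′ a (inj₂ x))) ≡ 2
place-apex-link p q′ a zero       (inj₁ i) = dist-grid p q′ (value a) zero (suc i)
place-apex-link p q′ a zero       (inj₂ j) = dist-grid p q′ (value a) (suc zero) (j ↑ˡ _)
place-apex-link p q′ a (suc zero) (inj₁ i) = dist-opposite-grid p q′ (value a) zero (suc i)
place-apex-link p q′ a (suc zero) (inj₂ j) = dist-opposite-grid p q′ (value a) (suc zero) (j ↑ˡ _)

place-preserves : ∀ {m} p q′ (a : Vertex (Δ (4 + m))) x y →
  Adj (J (1 + m)) x y → Adj (Δ (4 + m)) (place p q′ a x) (place p q′ a y)
place-preserves p q′ a (inj₁ zero) (inj₁ zero) x≢y = contradiction refl x≢y
place-preserves p q′ a (inj₁ zero) (inj₁ (suc zero)) _ = dist-opposite p q′ (value a)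
place-preserves p q′ a (inj₁ (suc zero)) (inj₁ zero) _ =
  trans (dist-sym _ (value a)) (dist-opposite p q′ (value a))
place-preserves p q′ a (inj₁ (suc zero)) (inj₁ (suc zero)) x≢y = contradiction refl x≢y
place-preserves p q′ a (inj₁ t) (inj₂ x) _ = place-apex-link p q′ a t x
place-preserves p q′ a (inj₂ x) (inj₁ t) _ = trans
  (dist-sym (value (place p q′ a (inj₂ x))) (value (place p q′ a (inj₁ t))))
  (place-apex-link p q′ a t x)
place-preserves p q′ a (inj₂ (inj₁ i)) (inj₂ (inj₁ j)) (inj₁ i≢j) =
  grid-row p q′ (value a) zero (i≢j ∘ suc-injective)
place-preserves {m} p q′ a (inj₂ (inj₂ i)) (inj₂ (inj₂ j)) (inj₂ i≢j) =
  grid-row p q′ (value a) (suc zero) (i≢j ∘ ↑ˡ-injective m i j)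

DeletedPair : ∀ {m} (x y : Vertex (J (1 + m))) → Set
DeletedPair x y = (x ≡ c₀ × y ≡ d₁) ⊎ (x ≡ d₁ × y ≡ c₀)

-- Cells in different rows and different columns are at distance 4, hence distinct and non-adjacent.
-- In a common column they are still distinct, and the pair is the one whose edge is deleted.
place-apart : ∀ {m} p q′ (a : Vertex (Δ (4 + m))) {x y} → Apart x y →
  place p q′ a x ≢ place p q′ a y ×
  (Adj (Δ (4 + m)) (place p q′ a x) (place p q′ a y) → DeletedPair x y)
place-apart {m} p q′ a (clique-edge i j) with suc i ≟ j ↑ˡ m
... | no k≢l = dist≡suc⇒≢ d≡4 ∘ cong value , λ xy → contradiction (trans (sym xy) d≡4) λ ()
  where
  d≡4 : dist (grid p q′ (value a) zero (suc i)) (grid p q′ (value a) (suc zero) (j ↑ˡ m)) ≡ 4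
  d≡4 = grid-diagonal p q′ (value a) {zero} {suc zero} (λ ()) k≢l
-- The equation `suc i ≡ j ↑ˡ m` with `j` in `Fin 2` forces `i` to be 0 and `j` to be 1.
place-apart {m} p q′ a (clique-edge zero (suc zero)) | yes refl =
  dist≡suc⇒≢ (grid-column p q′ (value a) (suc zero) {zero} {suc zero} λ ()) ∘ cong value ,
  λ _ → inj₁ (refl , refl)
place-apart {m} p q′ a (edge-clique i j)
  with distinct , deleted ← place-apart p q′ a (clique-edge i j) =
  distinct ∘ sym , λ yx → case deleted
    (symm (Δ (4 + m)) {place p q′ a (inj₂ (inj₂ j))} {place p q′ a (inj₂ (inj₁ i))} yx) of λ
    { (inj₁ (x≡ , y≡)) → inj₂ (y≡ , x≡)
    ; (inj₂ (x≡ , y≡)) → inj₁ (y≡ , x≡)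
    }

place-injective : ∀ {m} p q′ (a : Vertex (Δ (4 + m))) {x y} →
  place p q′ a x ≡ place p q′ a y → x ≡ y
place-injective {m} p q′ a {x} {y} eq with equal-adjacent-or-apart x y
... | inj₁ x≡y         = x≡y
... | inj₂ (inj₁ xy)   =
  contradiction (cong value eq) (dist≡suc⇒≢ (place-preserves p q′ a x y xy))
... | inj₂ (inj₂ x∥y)  = contradiction eq (proj₁ (place-apart p q′ a x∥y))

-- By injectivity, an edge of `J` mapped onto the deleted edge would have to join `c₀` and `d₁`,
-- which are not adjacent. Conversely, the only non-edge of `J` that `place` sends to an edge of `Δ`
-- is that pair, and its image has been deleted.
place-embedding : ∀ {m} p q′ (a : Vertex (Δ (4 + m))) →
  InducedEmbedding (J (1 + m)) (deleteEdge (Δ (4 + m)) (place p q′ a c₀) (place p q′ a d₁))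
place-embedding {m} p q′ a = record
  { image     = place p q′ a
  ; injective = place-injective p q′ a
  ; preserves = λ {x} {y} xy → place-preserves p q′ a x y xy , λ
      { (inj₁ (x≡ , y≡)) → c₀≁d₁ (subst₂ (Adj (J (1 + m))) (inj {x} {c₀} x≡) (inj {y} {d₁} y≡) xy)
      ; (inj₂ (x≡ , y≡)) → c₀≁d₁ (subst₂ (Adj (J (1 + m))) (inj {y} {c₀} y≡) (inj {x} {d₁} x≡)
          (symm (J (1 + m)) {x} {y} xy))
      }
  ; reflects  = λ {x} {y} → reflects′ x y
  }
  where
  inj : ∀ {x y} → place p q′ a x ≡ place p q′ a y → x ≡ y
  inj = place-injective p q′ a
  c₀≁d₁ : ¬ Adj (J (1 + m)) c₀ d₁
  c₀≁d₁ ()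
  reflects′ : ∀ x y →
    Adj (deleteEdge (Δ (4 + m)) (place p q′ a c₀) (place p q′ a d₁))
      (place p q′ a x) (place p q′ a y) →
    Adj (J (1 + m)) x y
  reflects′ x y (xy , kept) with equal-adjacent-or-apart x y
  ... | inj₁ refl        = contradiction (refl {x = value (place p q′ a x)}) (dist≡suc⇒≢ xy)
  ... | inj₂ (inj₁ xy′)  = xy′
  ... | inj₂ (inj₂ x∥y) with proj₂ (place-apart p q′ a x∥y) xy
  ...   | inj₁ (refl , refl) = contradiction (inj₁ (refl , refl)) kept
  ...   | inj₂ (refl , refl) = contradiction (inj₂ (refl , refl)) kept

-- Deciding the image of the embedding, and conclusion for an arbitrary edge.

any⊎? : {A B : Set} {P : A ⊎ B → Set} →
  Dec (∃ (P ∘ inj₁)) → Dec (∃ (P ∘ inj₂)) → Dec (∃ P)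
any⊎? P₁? P₂? = map′
  (λ { (inj₁ (x , Px)) → inj₁ x , Px ; (inj₂ (y , Py)) → inj₂ y , Py })
  (λ { (inj₁ x , Px) → inj₁ (x , Px) ; (inj₂ y , Py) → inj₂ (y , Py) })
  (P₁? ⊎-dec P₂?)

any-J? : ∀ {m} {P : Vertex (J m) → Set} → (∀ x → Dec (P x)) → Dec (∃ P)
any-J? P? = any⊎? (any? λ x → P? (inj₁ x))
  (any⊎? (any? λ x → P? (inj₂ (inj₁ x))) (any? λ x → P? (inj₂ (inj₂ x))))

-- The edge uv has to become the column edge from `c₀` to `d₁`, so the base point of the grid is
-- computed backwards from `u`.
Δ-deletion : ∀ m u v → Adj (Δ (4 + m)) u v →
  ContainsInduced (deleteEdge (Δ (4 + m)) u v) (J (1 + m))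
Δ-deletion m u v uv with p , q′ , v≡ ← adjacent⇒opposite (value u) (value v) uv =
  subst₂ (λ u v → ContainsInduced (deleteEdge (Δ (4 + m)) u v) (J (1 + m)))
    (Refinement.value-injective c₀≡u) (Refinement.value-injective d₁≡v)
    (embedding⇒containsInduced (place-embedding p q′ a)
      (λ w → any-J? λ x → Refinement._≟_ (Vec.≡-dec Bool._≟_) (place p q′ a x) w))
  where
  -- `r` is the element of the shared column 1. Toggling `r` in `a` leaves `u` with `p` toggled;
  -- toggling `p` next gives `u`, and toggling q instead gives `v`.
  r = others p q′ (suc zero)
  a = toggle² r p u
  toggle-r-a : toggle r (value a) ≡ toggle p (value u)
  toggle-r-a = toggle-involutive r (toggle p (value u))
  c₀≡u : value (place p q′ a c₀) ≡ value u
  c₀≡u = trans (cong (toggle p) toggle-r-a) (toggle-involutive p (value u))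
  d₁≡v : value (place p q′ a d₁) ≡ value v
  d₁≡v = trans (cong (toggle (punchIn p q′)) toggle-r-a)
    (trans (toggle-comm (punchIn p q′) p (value u)) (sym v≡))

proposition6p2 : (m : ℕ) → 3 ≤ m → DeletionHost (Δ (m + 3)) (J m)
proposition6p2 (suc (suc (suc m))) (s≤s (s≤s (s≤s z≤n))) rewrite +-comm m 3 = record
  { hasEdge       = empty , toggle² zero (suc zero) empty ,
                    dist-two-zero {i = zero} {suc zero} (value empty) λ ()
  ; inducedFree   = Δ-free m
  -- `Δ-deletion` counts from `J (1 + m)` inside `Δ (4 + m)`, so the shift by 2 yields `J (3 + m)`
  -- inside `Δ (6 + m)`.
  ; deletionHasIt = Δ-deletion (2 + m)
  }
  where
  empty : Vertex (Δ (6 + m))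
  empty = ∅ Refinement., [ subst (2 ∣_) (sym (∣⊥∣≡0 (6 + m))) (2 ∣0) ]
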